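{- Let $G$ be a finite simple graph such that $G$ contains no induced subgraph isomorphic to the path $P_8$ on eight vertices, and such that every vertex of $G$ has degree at least $3$. Then $G$ contains a cycle of length $4$ or a cycle of length $8$ (not necessarily induced).
   Context: All graphs are finite, undirected and simple. $P_k$ denotes the path on $k$ vertices. A graph is $H$-free if it has no induced subgraph isomorphic to $H$. -}

module Defs where

open import Data.Nat using (ℕ; zero; suc; _+_; _≤_)
open import Data.Fin using (Fin; toℕ; zero; suc)
open import Data.List using (List; length; filter; allFin)
open import Data.Product using (Σ; _×_; _,_)
open import Relation.Nullary using (¬_; Dec)
open import Relation.Binary.PropositionalEquality using (_≡_)
open import Relation.Unary using (Decidable)
open import Function using (_⇔_)
open import Function.Definitions using (Injective)

record Graph (n : ℕ) : Set₁ where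
  field
    Adj     : Fin n → Fin n → Set
    adj?    : (u v : Fin n) → Dec (Adj u v)
    sym     : ∀ {u v} → Adj u v → Adj v u
    irrefl  : ∀ {u} → ¬ Adj u u

open Graph public

degree : ∀ {n} → Graph n → Fin n → ℕ
degree G v = length (filter (λ u → adj? G v u) (allFin _))

Consecutive : ∀ {k} → Fin k → Fin k → Set
Consecutive i j = (suc (toℕ i) ≡ toℕ j) Data.Sum.⊎ (suc (toℕ j) ≡ toℕ i)
  where import Data.Sum

HasInducedPath : ∀ {n} → Graph n → ℕ → Set
HasInducedPath {n} G k =
  Σ (Fin k → Fin n) λ f →
    Injective _≡_ _≡_ f × (∀ i j → Adj G (f i) (f j) ⇔ Consecutive i j)

-- G contains a (not necessarily induced) cycle of length k (used for k ≥ 3):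
-- distinct vertices f 0, …, f (k-1) with f i adjacent to f (i+1) and
-- f (k-1) adjacent to f 0.
HasCycle : ∀ {n} → Graph n → ℕ → Set
HasCycle {n} G k =
  Σ (Fin k → Fin n) λ f →
    Injective _≡_ _≡_ f
    × (∀ i j → suc (toℕ i) ≡ toℕ j → Adj G (f i) (f j))
    × (∀ i j → toℕ i ≡ 0 → suc (toℕ j) ≡ k → Adj G (f j) (f i))

{-# OPTIONS --safe #-}
-- For 1 ≤ m ≤ 7, an induced path on m vertices forces an induced path on m + 1 vertices, a C₄ or a
-- C₈; a single vertex is an induced path, so iterating reaches P₈ unless a cycle appears. Each of
-- these seven implications is a finite case tree grown from the induced path: a known vertex with
-- at most two candidates for neighbours among the known vertices has, its degree being at least 3,
-- a neighbour outside them; adding it and deciding some of its adjacencies always ends in one of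
-- the three structures. The trees were found by computer search and are checked by reflection.
module Submission where

open import Defs
open import Data.Nat using (ℕ; _≤_)
open import Data.Fin using (Fin)
open import Data.Sum using (_⊎_)
open import Relation.Nullary using (¬_)

open import Data.Bool using (Bool; true; false; T; not; if_then_else_; _∧_; _∨_)
import Data.Bool as Bool
import Data.Bool.Properties as Bool
open import Data.Bool.ListAction using (all; any)
open import Data.Fin using (zero; suc; toℕ; fromℕ<)
import Data.Fin.Properties as Fin
open import Data.List
  using (List; []; _∷_; length; lookup; map; filter; filterᵇ; concatMap; upTo; allFin)
open import Data.List.Membership.Propositional using (_∈_; _∉_; find)
open import Data.List.Membership.Propositional.Properties
  using (∈-filter⁺; ∈-filter⁻; ∈-map⁺; ∈-upTo⁺; ∈-upTo⁻; ∈-allFin; ∈-lookup)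
import Data.List.Membership.Setoid.Properties as SetoidMembership
open import Data.List.Properties using (length-map)
open import Data.List.Relation.Unary.All as All using (All; []; _∷_)
import Data.List.Relation.Unary.All.Properties as All
open import Data.List.Relation.Unary.AllPairs using (AllPairs; _∷_)
open import Data.List.Relation.Unary.Any as Any using (index)
import Data.List.Relation.Unary.Any.Properties as Any
open import Data.List.Relation.Unary.Unique.Propositional using (Unique)
import Data.List.Relation.Unary.Unique.Propositional.Properties as Unique
open import Data.Nat using (zero; suc; _<_; _≡ᵇ_; _<ᵇ_; _≤ᵇ_; _<?_; z≤n; s≤s; s<s⁻¹)
open import Data.Nat.Properties
  using ( ≡ᵇ⇒≡; ≡⇒≡ᵇ; <ᵇ⇒<; <⇒<ᵇ; ≤ᵇ⇒≤; ≤⇒≯; ≮⇒≥; <⇒≢; <-cmp; <-trans; ≤-<-trans; ≤-reflexive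
        ; n<1+n; m≤n⇒m≤1+n; m<1+n⇒m<n∨m≡n; <-asym; 1+n≢n)
open import Data.Product using (∃; _×_; _,_; proj₁; proj₂)
open import Data.Sum using (inj₁; inj₂; [_,_]′; swap)
open import Data.Vec as Vec using (Vec; []; _∷_)
open import Function using (_∘_; id; _⇔_; mk⇔; Equivalence)
open import Function.Definitions using (Injective)
open import Relation.Binary using (tri<; tri≈; tri>)
open import Relation.Binary.PropositionalEquality
  using (_≡_; _≢_; refl; cong; subst; ≢-sym; setoid) renaming (sym to ≡-sym)
open import Relation.Nullary using (yes; no; does; contradiction)
open import Relation.Nullary.Decidable using (T?; decidable-stable)
open import Relation.Nullary.Reflects using (Reflects; ofʸ; ofⁿ; fromEquivalence)

-- The degree bound yields a new vertex only where the possible neighbours are few, while every new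
-- vertex brings undecided pairs with it. Excluding C₄ resolves this: two vertices then share at
-- most one neighbour, so most pairs near a new edge are non-adjacent at once; many contacts between
-- more distant vertices close a C₈. The other pairs may stay undecided, since a cycle asks only for
-- its own edges and only a path asks for all of its pairs. Gaining one vertex at a time lets every
-- tree start from a path whose pairs are all decided. The longer path need not prolong the old one:
-- it is often rerouted through new vertices and leaves old ones out.

-- Booleans and lists without repetition.

∧⁻ : ∀ {a b} → T (a ∧ b) → T a × T b
∧⁻ = Equivalence.to Bool.T-∧

∨⁻ : ∀ {a b} → T (a ∨ b) → T a ⊎ T b
∨⁻ = Equivalence.to Bool.T-∨

T-not⁻ : ∀ {b} → T (not b) → ¬ T b
T-not⁻ {false} _ ()

AllPairs-lookup : ∀ {A : Set} {R : A → A → Set} {xs} → AllPairs R xs →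
  ∀ {i j} → toℕ i < toℕ j → R (lookup xs i) (lookup xs j)
AllPairs-lookup (Rx ∷ _)  {zero}  {suc j} _   = All.lookup Rx (∈-lookup j)
AllPairs-lookup (_ ∷ Rxs) {suc i} {suc j} i<j = AllPairs-lookup Rxs (s<s⁻¹ i<j)

-- Pigeonhole on the positions in `ys` at which the entries of `xs` occur: a collision would repeat
-- an entry of `xs`. It serves to compare a degree, which is a list length, with a number of
-- candidates.
unique-⊆-length : ∀ {A : Set} {xs ys : List A} →
  Unique xs → All (_∈ ys) xs → length xs ≤ length ys
unique-⊆-length {xs = xs} {ys} uniq xs⊆ys with length ys <? length xs
... | no ≮ = ≮⇒≥ ≮
... | yes short
  with i , j , i<j , eq ← Fin.pigeonhole short (λ i → index (All.lookup xs⊆ys (∈-lookup i)))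
  = contradiction (SetoidMembership.index-injective (setoid _) _ _ eq) (AllPairs-lookup uniq i<j)

-- Facts about the known vertices and Boolean tests on them.

-- fact true i j: known vertices i and j are adjacent; fact false i j: they are not. A pair without
-- a fact is undecided, so a list of facts describes a partially explored induced subgraph.
data Fact : Set where
  fact : Bool → ℕ → ℕ → Fact

-- Adjacency is symmetric, so the order in which a fact names its two vertices is ignored.
sameᵇ : Fact → Fact → Bool
sameᵇ (fact b i j) (fact c k l) =
  does (b Bool.≟ c) ∧ ((i ≡ᵇ k) ∧ (j ≡ᵇ l) ∨ (i ≡ᵇ l) ∧ (j ≡ᵇ k))

known : List Fact → Bool → ℕ → ℕ → Bool
known Γ b i j = any (sameᵇ (fact b i j)) Γ

pairs : ∀ {m} → (Fin m → Fin m → Bool) → Bool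
pairs p = all (λ j → all (λ i → not (toℕ i <ᵇ toℕ j) ∨ p i j) (allFin _)) (allFin _)

pairs⁻ : ∀ {m} (p : Fin m → Fin m → Bool) → T (pairs p) → ∀ {i j} → toℕ i < toℕ j → T (p i j)
pairs⁻ p ok {i} {j} i<j =
  [ (λ i≮j → contradiction (<⇒<ᵇ i<j) (T-not⁻ i≮j)) , id ]′
    (∨⁻ (All.lookup (All.all⁺ _ _ (All.lookup (All.all⁺ _ _ ok) (∈-allFin j))) (∈-allFin i)))

distinct : ℕ → ℕ → ℕ → Bool
distinct k i j = (i <ᵇ k) ∧ (j <ᵇ k) ∧ not (i ≡ᵇ j)

-- Chords may be undecided, so distinctness has to be tested separately: there need not be a fact
-- for every pair. The closing edge appears as the positions 0 and m - 1, in this order, because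
-- `pairs` puts the smaller position first.
isCycle : ∀ {m} → ℕ → List Fact → Vec ℕ m → Bool
isCycle {m} k Γ vs = pairs λ i j →
  let u = Vec.lookup vs i ; v = Vec.lookup vs j in
  distinct k u v ∧
  (not ((suc (toℕ i) ≡ᵇ toℕ j) ∨ (toℕ i ≡ᵇ 0) ∧ (suc (toℕ j) ≡ᵇ m)) ∨ known Γ true u v)

-- Distinctness needs no test here: every pair must have a fact, and `Holds` makes the vertices of a
-- fact distinct.
isInducedPath : ∀ {m} → List Fact → Vec ℕ m → Bool
isInducedPath Γ vs =
  pairs λ i j → known Γ (suc (toℕ i) ≡ᵇ toℕ j) (Vec.lookup vs i) (Vec.lookup vs j)

pathFacts : ℕ → List Fact
pathFacts m = concatMap (λ j → map (λ i → fact (suc i ≡ᵇ j) i j) (upTo j)) (upTo m)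

-- Undecided pairs count as possible edges, so that the length bounds the number of known neighbours
-- from above.
possibleNeighbours : ℕ → List Fact → ℕ → List ℕ
possibleNeighbours k Γ v = filterᵇ (λ u → not (v ≡ᵇ u) ∧ not (known Γ false v u)) (upTo k)

-- Case trees and their checker.

-- A case tree deriving an induced path on m vertices or one of the cycles. The vertices known so far
-- are 0, …, k - 1. The first branch of split assumes i and j adjacent, the second non-adjacent;
-- expand v names k a neighbour of v that is none of the known vertices.
data Certificate (m : ℕ) : Set where
  path   : Vec ℕ m → Certificate m
  cycle₄ : (a b c d : ℕ) → Certificate m
  cycle₈ : (a b c d e f g h : ℕ) → Certificate m
  split  : (i j : ℕ) → Certificate m → Certificate m → Certificate m
  expand : (v : ℕ) → Certificate m → Certificate m

check : ∀ {m} → ℕ → List Fact → Certificate m → Bool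
check k Γ (path vs)                = isInducedPath Γ vs
check k Γ (cycle₄ a b c d)         = isCycle k Γ (a ∷ b ∷ c ∷ d ∷ [])
check k Γ (cycle₈ a b c d e f g h) = isCycle k Γ (a ∷ b ∷ c ∷ d ∷ e ∷ f ∷ g ∷ h ∷ [])
check k Γ (split i j adj nonadj)   =
  distinct k i j ∧ check k (fact true i j ∷ Γ) adj ∧ check k (fact false i j ∷ Γ) nonadj
check k Γ (expand v c)             =
  -- The bound 2 is one less than the minimum degree. The new vertex `k` enters with a single fact;
  -- its other adjacencies stay undecided until a `split`.
  (v <ᵇ k) ∧ (length (possibleNeighbours k Γ v) ≤ᵇ 2) ∧ check (suc k) (fact true v k ∷ Γ) c

-- Soundness of the checker in a graph.

module _ {n} (G : Graph n) where

  open import Data.List.Membership.DecPropositional (Fin._≟_ {n}) using (_∈?_; _∉?_)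

  Holds : ℕ → (ℕ → Fin n) → Fact → Set
  Holds k ρ (fact b i j) = i < k × j < k × i ≢ j × Reflects (Adj G (ρ i) (ρ j)) b

  -- The assignment `ρ` is defined on all of ℕ but constrained only below `k`, so a new vertex is an
  -- update at `k` and vertex names keep their type as `k` grows.
  record Realises (k : ℕ) (Γ : List Fact) (ρ : ℕ → Fin n) : Set where
    field
      injective : ∀ {i j} → i < k → j < k → i ≢ j → ρ i ≢ ρ j
      facts     : All (Holds k ρ) Γ

  open Realises

  Reflects-Adj-sym : ∀ {u v b} → Reflects (Adj G u v) b → Reflects (Adj G v u) b
  Reflects-Adj-sym (ofʸ uv)  = ofʸ (sym G uv)
  Reflects-Adj-sym (ofⁿ ¬uv) = ofⁿ (¬uv ∘ sym G)

  Holds-sym : ∀ {k ρ b i j} → Holds k ρ (fact b i j) → Holds k ρ (fact b j i)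
  Holds-sym (i<k , j<k , i≢j , r) = j<k , i<k , ≢-sym i≢j , Reflects-Adj-sym r

  Holds-same : ∀ {k ρ} f g → T (sameᵇ f g) → Holds k ρ g → Holds k ρ f
  Holds-same (fact b i j) (fact c k l) same h with b Bool.≟ c
  ... | yes refl with ∨⁻ {(i ≡ᵇ k) ∧ (j ≡ᵇ l)} same
  ...   | inj₁ p rewrite ≡ᵇ⇒≡ i k (proj₁ (∧⁻ p)) | ≡ᵇ⇒≡ j l (proj₂ (∧⁻ {i ≡ᵇ k} p)) = h
  ...   | inj₂ p rewrite ≡ᵇ⇒≡ i l (proj₁ (∧⁻ p)) | ≡ᵇ⇒≡ j k (proj₂ (∧⁻ {i ≡ᵇ l} p)) = Holds-sym h

  known-sound : ∀ {k Γ ρ} b i j → Realises k Γ ρ → T (known Γ b i j) → Holds k ρ (fact b i j)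
  known-sound {Γ = Γ} b i j R kn with g , g∈Γ , same ← find (Any.any⁻ (sameᵇ (fact b i j)) Γ kn) =
    Holds-same (fact b i j) g same (All.lookup (facts R) g∈Γ)

  known-adj : ∀ {k Γ ρ} i j → Realises k Γ ρ → T (known Γ true i j) → Adj G (ρ i) (ρ j)
  known-adj i j R kn with _ , _ , _ , ofʸ a ← known-sound true i j R kn = a

  distinct-sound : ∀ k i j → T (distinct k i j) → i < k × j < k × i ≢ j
  distinct-sound k i j d with d₁ , d′ ← ∧⁻ {i <ᵇ k} d with d₂ , d₃ ← ∧⁻ {j <ᵇ k} d′ =
    <ᵇ⇒< i k d₁ , <ᵇ⇒< j k d₂ , T-not⁻ d₃ ∘ ≡⇒≡ᵇ i j

  separated⇒injective : ∀ {m} (f : Fin m → Fin n) →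
    (∀ {i j} → toℕ i < toℕ j → f i ≢ f j) → Injective _≡_ _≡_ f
  separated⇒injective f sep {i} {j} fi≡fj with <-cmp (toℕ i) (toℕ j)
  ... | tri< i<j _ _ = contradiction fi≡fj (sep i<j)
  ... | tri≈ _ i≡j _ = Fin.toℕ-injective i≡j
  ... | tri> _ _ j<i = contradiction (≡-sym fi≡fj) (sep j<i)

  isCycle-sound : ∀ {m k Γ ρ} (vs : Vec ℕ m) → 2 ≤ m →
    Realises k Γ ρ → T (isCycle k Γ vs) → HasCycle G m
  isCycle-sound {m} {k} {Γ} {ρ} vs 2≤m R ok =
    ρ ∘ Vec.lookup vs , separated⇒injective _ separated , consecutive , closing
    where
    u = Vec.lookup vs

    separated : ∀ {i j} → toℕ i < toℕ j → ρ (u i) ≢ ρ (u j)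
    separated {i} {j} i<j
      with p , q , r ← distinct-sound k (u i) (u j) (proj₁ (∧⁻ (pairs⁻ _ ok i<j))) = injective R p q r

    edge : ∀ {i j} → toℕ i < toℕ j →
      T ((suc (toℕ i) ≡ᵇ toℕ j) ∨ (toℕ i ≡ᵇ 0) ∧ (suc (toℕ j) ≡ᵇ m)) → Adj G (ρ (u i)) (ρ (u j))
    edge {i} {j} i<j e =
      [ (λ ¬e → contradiction e (T-not⁻ ¬e)) , known-adj (u i) (u j) R ]′
        (∨⁻ (proj₂ (∧⁻ {distinct k (u i) (u j)} (pairs⁻ _ ok i<j))))

    consecutive : ∀ i j → suc (toℕ i) ≡ toℕ j → Adj G (ρ (u i)) (ρ (u j))
    consecutive i j i+1≡j =
      edge (≤-reflexive i+1≡j) (Equivalence.from Bool.T-∨ (inj₁ (≡⇒≡ᵇ _ _ i+1≡j)))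

    closing : ∀ i j → toℕ i ≡ 0 → suc (toℕ j) ≡ m → Adj G (ρ (u j)) (ρ (u i))
    -- `edge` wants the smaller position first, whence the use of `sym`; `2 ≤ m` puts position 0
    -- strictly before position m - 1.
    closing i j i≡0 j+1≡m = sym G (edge
      (subst (_< toℕ j) (≡-sym i≡0) (s<s⁻¹ (subst (1 <_) (≡-sym j+1≡m) 2≤m)))
      (Equivalence.from (Bool.T-∨ {suc (toℕ i) ≡ᵇ toℕ j})
        (inj₂ (Equivalence.from Bool.T-∧ (≡⇒≡ᵇ _ _ i≡0 , ≡⇒≡ᵇ _ _ j+1≡m)))))

  isInducedPath-sound : ∀ {m k Γ ρ} (vs : Vec ℕ m) →
    Realises k Γ ρ → T (isInducedPath Γ vs) → HasInducedPath G m
  isInducedPath-sound {m} {k} {Γ} {ρ} vs R ok = ρ ∘ u , separated⇒injective _ separated , adjacency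
    where
    u = Vec.lookup vs

    holds : ∀ {i j} → toℕ i < toℕ j → Holds k ρ (fact (suc (toℕ i) ≡ᵇ toℕ j) (u i) (u j))
    holds i<j = known-sound _ _ _ R (pairs⁻ _ ok i<j)

    separated : ∀ {i j} → toℕ i < toℕ j → ρ (u i) ≢ ρ (u j)
    separated i<j with p , q , r , _ ← holds i<j = injective R p q r

    forward : ∀ {i j} → toℕ i < toℕ j → Adj G (ρ (u i)) (ρ (u j)) ⇔ Consecutive i j
    -- The Boolean stored in the fact is the test for consecutive positions itself, so one case
    -- distinction settles both sides of the equivalence.
    forward {i} {j} i<j with suc (toℕ i) ≡ᵇ toℕ j in eq | holds i<j
    ... | true  | _ , _ , _ , ofʸ a  =
      mk⇔ (λ _ → inj₁ (≡ᵇ⇒≡ _ _ (Equivalence.from Bool.T-≡ eq))) (λ _ → a)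
    ... | false | _ , _ , _ , ofⁿ ¬a =
      mk⇔ (λ a → contradiction a ¬a)
          [ (λ i+1≡j → contradiction (≡⇒≡ᵇ _ _ i+1≡j) (subst T eq))
          , (λ j+1≡i → contradiction i<j (<-asym (≤-reflexive j+1≡i))) ]′

    adjacency : ∀ i j → Adj G (ρ (u i)) (ρ (u j)) ⇔ Consecutive i j
    adjacency i j with <-cmp (toℕ i) (toℕ j)
    ... | tri< i<j _ _ = forward i<j
    ... | tri> _ _ j<i =
      mk⇔ (swap ∘ Equivalence.to (forward j<i) ∘ sym G)
          (sym G ∘ Equivalence.from (forward j<i) ∘ swap)
    ... | tri≈ _ i≡j _ with refl ← Fin.toℕ-injective i≡j =
      mk⇔ (λ a → contradiction a (irrefl G))
          [ (λ e → contradiction e 1+n≢n) , (λ e → contradiction e 1+n≢n) ]′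

  updated : (ℕ → Fin n) → ℕ → Fin n → ℕ → Fin n
  updated ρ k x i = if i ≡ᵇ k then x else ρ i

  updated-new : ∀ ρ k x → updated ρ k x k ≡ x
  updated-new ρ k x with k ≡ᵇ k in eq
  ... | true  = refl
  ... | false = contradiction (≡⇒≡ᵇ k k refl) (subst T eq)

  updated-old : ∀ ρ {k} x {i} → i < k → updated ρ k x i ≡ ρ i
  updated-old ρ {k} x {i} i<k with i ≡ᵇ k in eq
  ... | false = refl
  ... | true  = contradiction (≡ᵇ⇒≡ i k (Equivalence.from Bool.T-≡ eq)) (<⇒≢ i<k)

  Realises-assume : ∀ {k Γ ρ b i j} → Realises k Γ ρ → T (distinct k i j) →
    Reflects (Adj G (ρ i) (ρ j)) b → Realises k (fact b i j ∷ Γ) ρ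
  Realises-assume {k} {i = i} {j} R d r with i<k , j<k , i≢j ← distinct-sound k i j d = record
    { injective = injective R ; facts = (i<k , j<k , i≢j , r) ∷ facts R }

  -- Earlier facts mention only indices below `k`, where the update changes nothing.
  Realises-new : ∀ {k Γ ρ v x} → Realises k Γ ρ → v < k → Adj G (ρ v) x →
    (∀ {u} → u < k → x ≢ ρ u) → Realises (suc k) (fact true v k ∷ Γ) (updated ρ k x)
  Realises-new {k} {Γ} {ρ} {v} {x} R v<k vx new = record
    { injective = inj ; facts = newFact ∷ All.map weaken (facts R) }
    where
    ρ′ = updated ρ k x

    inj : ∀ {i j} → i < suc k → j < suc k → i ≢ j → ρ′ i ≢ ρ′ j
    inj i<1+k j<1+k i≢j with m<1+n⇒m<n∨m≡n i<1+k | m<1+n⇒m<n∨m≡n j<1+k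
    ... | inj₁ i<k  | inj₁ j<k
      rewrite updated-old ρ x i<k | updated-old ρ x j<k = injective R i<k j<k i≢j
    ... | inj₁ i<k  | inj₂ refl
      rewrite updated-old ρ x i<k | updated-new ρ k x = ≢-sym (new i<k)
    ... | inj₂ refl | inj₁ j<k
      rewrite updated-old ρ x j<k | updated-new ρ k x = new j<k
    ... | inj₂ refl | inj₂ refl = contradiction refl i≢j

    newFact : Holds (suc k) ρ′ (fact true v k)
    newFact rewrite updated-old ρ x v<k | updated-new ρ k x =
      m≤n⇒m≤1+n v<k , n<1+n k , <⇒≢ v<k , ofʸ vx

    weaken : ∀ {f} → Holds k ρ f → Holds (suc k) ρ′ f
    weaken {fact b i j} (i<k , j<k , i≢j , r) rewrite updated-old ρ x i<k | updated-old ρ x j<k =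
      m≤n⇒m≤1+n i<k , m≤n⇒m≤1+n j<k , i≢j , r

  -- The degree counts a list without repetition; if all its entries lay in `ys`, it could not be
  -- longer than `ys`.
  neighbour-outside : ∀ v ys → length ys < degree G v → ∃ λ x → Adj G v x × x ∉ ys
  neighbour-outside v ys short with Any.any? (_∉? ys) (filter (adj? G v) (allFin n))
  ... | yes outside with x , x∈ , x∉ ← find outside =
    x , proj₂ (∈-filter⁻ (adj? G v) {xs = allFin n} x∈) , x∉
  ... | no none = contradiction short (≤⇒≯ (unique-⊆-length
    (Unique.filter⁺ (adj? G v) (Unique.allFin⁺ n))
    (All.map (λ {x} → decidable-stable (x ∈? ys)) (All.¬Any⇒All¬ _ none))))

  -- A known vertex adjacent to `ρ v` is always among the possible neighbours, so a neighbour that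
  -- avoids these few avoids every known vertex.
  new-neighbour : ∀ {k Γ ρ} v → Realises k Γ ρ → length (possibleNeighbours k Γ v) < degree G (ρ v) →
    ∃ λ x → Adj G (ρ v) x × (∀ {u} → u < k → x ≢ ρ u)
  new-neighbour {k} {Γ} {ρ} v R short
    with x , vx , x∉ ← neighbour-outside (ρ v) (map ρ (possibleNeighbours k Γ v))
           (subst (_< degree G (ρ v)) (≡-sym (length-map ρ (possibleNeighbours k Γ v))) short)
    = x , vx , new vx x∉
    where
    possible : ∀ u → Adj G (ρ v) (ρ u) → T (not (v ≡ᵇ u) ∧ not (known Γ false v u))
    possible u vu with v ≡ᵇ u in eq | known Γ false v u in kn
    ... | true  | _ with refl ← ≡ᵇ⇒≡ v u (Equivalence.from Bool.T-≡ eq) = irrefl G vu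
    ... | false | false = _
    ... | false | true
      with _ , _ , _ , ofⁿ ¬vu ← known-sound false v u R (Equivalence.from Bool.T-≡ kn) = ¬vu vu

    new : ∀ {x} → Adj G (ρ v) x → x ∉ map ρ (possibleNeighbours k Γ v) →
      ∀ {u} → u < k → x ≢ ρ u
    new vx x∉ {u} u<k refl = x∉ (∈-map⁺ ρ (∈-filter⁺ (T? ∘ _) (∈-upTo⁺ u<k) (possible u vx)))

  Outcome : ℕ → Set
  Outcome m = HasInducedPath G m ⊎ (HasCycle G 4 ⊎ HasCycle G 8)

  check-sound : (∀ v → 3 ≤ degree G v) → ∀ {m k Γ ρ} (c : Certificate m) →
    Realises k Γ ρ → T (check k Γ c) → Outcome m
  check-sound deg≥3 (path vs) R ok = inj₁ (isInducedPath-sound vs R ok)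
  check-sound deg≥3 (cycle₄ a b c d) R ok =
    inj₂ (inj₁ (isCycle-sound (a ∷ b ∷ c ∷ d ∷ []) (s≤s (s≤s z≤n)) R ok))
  check-sound deg≥3 (cycle₈ a b c d e f g h) R ok =
    inj₂ (inj₂ (isCycle-sound (a ∷ b ∷ c ∷ d ∷ e ∷ f ∷ g ∷ h ∷ []) (s≤s (s≤s z≤n)) R ok))
  check-sound deg≥3 {k = k} {Γ} {ρ} (split i j c₁ c₂) R ok
    with d , ok′ ← ∧⁻ {distinct k i j} ok
    with ok₁ , ok₂ ← ∧⁻ {check k (fact true i j ∷ Γ) c₁} ok′
    -- Decidability of adjacency selects the branch whose assumption is true in `G`.
    with adj? G (ρ i) (ρ j)
  ... | yes a = check-sound deg≥3 c₁ (Realises-assume R d (ofʸ a)) ok₁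
  ... | no ¬a = check-sound deg≥3 c₂ (Realises-assume R d (ofⁿ ¬a)) ok₂
  check-sound deg≥3 {k = k} {Γ} {ρ} (expand v c) R ok
    with v<k , ok′ ← ∧⁻ {v <ᵇ k} ok
    with few , ok″ ← ∧⁻ {length (possibleNeighbours k Γ v) ≤ᵇ 2} ok′
    with x , vx , new ← new-neighbour v R (≤-<-trans (≤ᵇ⇒≤ _ 2 few) (deg≥3 (ρ v)))
    = check-sound deg≥3 c (Realises-new R (<ᵇ⇒< v k v<k) vx new) ok″

  inducedPath-realises : ∀ {m} → HasInducedPath G (suc m) → ∃ (Realises (suc m) (pathFacts (suc m)))
  inducedPath-realises {m} (f , f-inj , f-adj) = ρ , record { injective = inj ; facts = holds }
    where
    ρ : ℕ → Fin n
    ρ i with i <? suc m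
    ... | yes i<1+m = f (fromℕ< i<1+m)
    -- A default beyond the path, where `Realises` says nothing about `ρ`; a path on `suc m`
    -- vertices has a vertex `f zero` to offer.
    ... | no  _     = f zero

    ρ≡ : ∀ {i} (i<1+m : i < suc m) → ρ i ≡ f (fromℕ< i<1+m)
    ρ≡ {i} i<1+m with i <? suc m
    ... | yes _ = cong f (Fin.fromℕ<-cong _ _ refl _ _)
    ... | no  ≮ = contradiction i<1+m ≮

    inj : ∀ {i j} → i < suc m → j < suc m → i ≢ j → ρ i ≢ ρ j
    inj i< j< i≢j eq rewrite ρ≡ i< | ρ≡ j< = i≢j (Fin.fromℕ<-injective _ _ i< j< (f-inj eq))

    holdsPair : ∀ {i j} → j < suc m → i < j → Holds (suc m) ρ (fact (suc i ≡ᵇ j) i j)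
    holdsPair {i} {j} j< i<j = i< , j< , <⇒≢ i<j , adjacency
      where
      i< = <-trans i<j j<
      adjacency : Reflects (Adj G (ρ i) (ρ j)) (suc i ≡ᵇ j)
      adjacency rewrite ρ≡ i< | ρ≡ j< with f-adj (fromℕ< i<) (fromℕ< j<)
      ... | eqv rewrite Fin.toℕ-fromℕ< i< | Fin.toℕ-fromℕ< j< = fromEquivalence
        (Equivalence.from eqv ∘ inj₁ ∘ ≡ᵇ⇒≡ (suc i) j)
        ([ ≡⇒≡ᵇ (suc i) j , (λ e → contradiction i<j (<-asym (≤-reflexive e))) ]′ ∘ Equivalence.to eqv)

    holds : All (Holds (suc m) ρ) (pathFacts (suc m))
    holds = All.concat⁺ (All.map⁺ (All.tabulate λ j∈ →
      All.map⁺ (All.tabulate λ i∈ → holdsPair (∈-upTo⁻ j∈) (∈-upTo⁻ i∈))))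

  -- A cycle found for a shorter path is passed on. For a concrete valid certificate the check
  -- evaluates to `true`, so its proof can be given as `_`.
  lengthen : (∀ v → 3 ≤ degree G v) → ∀ {m} (c : Certificate (suc (suc m))) →
    T (check (suc m) (pathFacts (suc m)) c) → Outcome (suc m) → Outcome (suc (suc m))
  lengthen deg≥3 c ok = [ (λ P → check-sound deg≥3 c (proj₂ (inducedPath-realises P)) ok) , inj₂ ]′

-- The seven case trees.

-- For a known path i a b j: if i and j were adjacent, i a b j would be a C₄.
far : ∀ {m} → (i a b j : ℕ) → Certificate m → Certificate m
far i a b j = split i j (cycle₄ i a b j)

certificate2 : Certificate 2
certificate2 =
  expand 0 (path (0 ∷ 1 ∷ []))

-- The triangle pattern of all larger trees: if the new neighbour 2 of the end 0 also sees the next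
-- vertex 1, then 0 has a third neighbour 3, and 3 cannot see 1 without closing the C₄ `3 0 2 1`.
certificate3 : Certificate 3
certificate3 =
  expand 0 (split 2 1 (expand 0 (far 3 0 2 1 (path (1 ∷ 0 ∷ 3 ∷ [])))) (path (1 ∷ 0 ∷ 2 ∷ [])))

certificate4 : Certificate 4
certificate4 =
  expand 0 (far 3 0 1 2 (split 3 1 (expand 0 (far 4 0 3 1 (far 4 0 1 2
  (path (2 ∷ 1 ∷ 0 ∷ 4 ∷ []))))) (path (2 ∷ 1 ∷ 0 ∷ 3 ∷ []))))

-- If the new neighbour 4 of 0 sees 3, a C₅ arises. A third neighbour 5 of 0 cannot see both 1 and 4
-- without a C₄, so a path from 5 through 0 goes round the C₅ on a side that 5 misses.
certificate5 : Certificate 5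
certificate5 =
  expand 0 (far 4 0 1 2 (split 4 1 (far 4 1 2 3 (expand 0 (far 5 0 4 1 (far 5 0 1 2 (far 5 0 1 4
  (split 5 3 (path (4 ∷ 0 ∷ 5 ∷ 3 ∷ 2 ∷ [])) (path (3 ∷ 2 ∷ 1 ∷ 0 ∷ 5 ∷ [])))))))) (split 4 3
  (expand 0 (far 5 0 1 2 (far 5 0 4 3 (split 5 1 (far 5 1 0 4 (path (2 ∷ 3 ∷ 4 ∷ 0 ∷ 5 ∷ [])))
  (path (3 ∷ 2 ∷ 1 ∷ 0 ∷ 5 ∷ [])))))) (path (3 ∷ 2 ∷ 1 ∷ 0 ∷ 4 ∷ [])))))

-- The first new vertex 5 hangs on the middle of the path. It pays off when a neighbour 6 of the end
-- 4 turns back to 0: the path `5 2 1 0 6 4` then avoids 3 and has 5 as an end.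
certificate6 : Certificate 6
certificate6 =
  expand 2 (far 5 2 1 0 (far 5 2 3 4 (split 5 1 (far 5 1 2 3 (expand 0 (far 6 0 1 2 (far 6 0 1 5
  (split 6 1 (expand 0 (far 7 0 6 1 (far 7 0 1 2 (far 7 0 1 5 (split 7 4 (cycle₈ 7 0 6 1 5 2 3 4)
  (split 7 3 (path (5 ∷ 1 ∷ 0 ∷ 7 ∷ 3 ∷ 4 ∷ [])) (path (4 ∷ 3 ∷ 2 ∷ 1 ∷ 0 ∷ 7 ∷ []))))))))
  (split 6 3 (split 6 4 (expand 0 (far 7 0 1 2 (far 7 0 6 3 (far 7 0 6 4 (split 7 1
  (cycle₈ 7 0 6 4 3 2 5 1) (path (4 ∷ 3 ∷ 2 ∷ 1 ∷ 0 ∷ 7 ∷ [])))))))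
  (path (5 ∷ 1 ∷ 0 ∷ 6 ∷ 3 ∷ 4 ∷ []))) (split 6 4 (path (5 ∷ 1 ∷ 0 ∷ 6 ∷ 4 ∷ 3 ∷ []))
  (path (4 ∷ 3 ∷ 2 ∷ 1 ∷ 0 ∷ 6 ∷ []))))))))) (expand 4 (far 6 4 3 2 (split 6 1 (far 6 1 2 5
  (expand 4 (far 7 4 6 1 (far 7 4 3 2 (split 7 3 (far 7 3 2 5 (far 7 3 4 6
  (path (5 ∷ 2 ∷ 1 ∷ 6 ∷ 4 ∷ 7 ∷ [])))) (split 7 0 (split 7 5 (cycle₈ 7 0 1 6 4 3 2 5)
  (path (5 ∷ 2 ∷ 1 ∷ 0 ∷ 7 ∷ 4 ∷ []))) (path (0 ∷ 1 ∷ 2 ∷ 3 ∷ 4 ∷ 7 ∷ [])))))))) (split 6 3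
  (far 6 3 2 5 (split 6 0 (path (5 ∷ 2 ∷ 1 ∷ 0 ∷ 6 ∷ 4 ∷ [])) (expand 4 (far 7 4 3 2 (far 7 4 6 3
  (far 7 4 3 6 (split 7 1 (far 7 1 2 5 (path (5 ∷ 2 ∷ 1 ∷ 7 ∷ 4 ∷ 6 ∷ []))) (split 7 0
  (path (2 ∷ 1 ∷ 0 ∷ 7 ∷ 4 ∷ 6 ∷ [])) (path (0 ∷ 1 ∷ 2 ∷ 3 ∷ 4 ∷ 7 ∷ [])))))))))) (split 6 0
  (split 6 5 (expand 0 (far 7 0 1 2 (far 7 0 6 4 (split 7 3 (cycle₈ 7 0 1 2 5 6 4 3) (split 7 1
  (far 7 1 0 6 (path (2 ∷ 3 ∷ 4 ∷ 6 ∷ 0 ∷ 7 ∷ []))) (path (4 ∷ 3 ∷ 2 ∷ 1 ∷ 0 ∷ 7 ∷ [])))))))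
  (path (5 ∷ 2 ∷ 1 ∷ 0 ∷ 6 ∷ 4 ∷ []))) (path (0 ∷ 1 ∷ 2 ∷ 3 ∷ 4 ∷ 6 ∷ []))))))))))

-- A contact of the new neighbour 6 of 5 with 3 closes a C₄, but contacts with 2, 1, 0 close cycles
-- of lengths 5, 6, 7 and a contact with 4 a triangle. These are the cases that need further
-- vertices.
certificate7 : Certificate 7
certificate7 =
  expand 5 (far 6 5 4 3 (split 6 2 (far 6 2 1 0 (expand 0 (far 7 0 1 2 (split 7 3
  (cycle₈ 7 0 1 2 6 5 4 3) (split 7 1 (expand 0 (far 8 0 7 1 (far 8 0 1 2 (split 8 3
  (cycle₈ 8 0 1 2 6 5 4 3) (split 8 4 (cycle₈ 8 0 7 1 2 6 5 4) (split 8 5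
  (cycle₈ 8 0 7 1 2 3 4 5) (path (5 ∷ 4 ∷ 3 ∷ 2 ∷ 1 ∷ 0 ∷ 8 ∷ [])))))))) (split 7 4 (expand 0
  (far 8 0 1 2 (far 8 0 7 4 (split 8 1 (cycle₈ 8 0 7 4 5 6 2 1) (split 8 3
  (cycle₈ 8 0 1 2 6 5 4 3) (split 8 5 (cycle₈ 8 0 7 4 3 2 6 5)
  (path (5 ∷ 4 ∷ 3 ∷ 2 ∷ 1 ∷ 0 ∷ 8 ∷ [])))))))) (split 7 5 (expand 0 (far 8 0 1 2 (far 8 0 7 5
  (split 8 1 (cycle₈ 8 0 7 5 4 3 2 1) (split 8 3 (cycle₈ 8 0 1 2 6 5 4 3) (split 8 4
  (cycle₈ 8 0 7 5 6 2 3 4) (path (5 ∷ 4 ∷ 3 ∷ 2 ∷ 1 ∷ 0 ∷ 8 ∷ []))))))))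
  (path (5 ∷ 4 ∷ 3 ∷ 2 ∷ 1 ∷ 0 ∷ 7 ∷ []))))))))) (split 6 0 (split 6 1 (split 6 4 (expand 5
  (far 7 5 6 0 (far 7 5 6 1 (far 7 5 4 3 (far 7 5 6 4 (split 7 2 (expand 0 (far 8 0 6 1
  (far 8 0 1 2 (far 8 0 6 4 (far 8 0 6 5 (split 8 3 (cycle₈ 8 0 1 2 7 5 4 3)
  (path (5 ∷ 4 ∷ 3 ∷ 2 ∷ 1 ∷ 0 ∷ 8 ∷ [])))))))) (path (0 ∷ 1 ∷ 2 ∷ 3 ∷ 4 ∷ 5 ∷ 7 ∷ []))))))))
  (expand 2 (far 7 2 1 0 (far 7 2 3 4 (far 7 2 1 6 (split 7 3 (cycle₈ 7 2 1 0 6 5 4 3) (split 7 5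
  (expand 0 (far 8 0 6 1 (far 8 0 1 2 (far 8 0 6 5 (split 8 3 (cycle₈ 8 0 1 2 7 5 4 3) (split 8 4
  (cycle₈ 8 0 6 1 2 7 5 4) (path (5 ∷ 4 ∷ 3 ∷ 2 ∷ 1 ∷ 0 ∷ 8 ∷ []))))))))
  (path (0 ∷ 6 ∷ 5 ∷ 4 ∷ 3 ∷ 2 ∷ 7 ∷ []))))))))) (split 6 4 (expand 0 (far 7 0 1 2 (far 7 0 6 4
  (far 7 0 6 5 (split 7 1 (cycle₈ 7 0 6 5 4 3 2 1) (split 7 3 (expand 1 (far 8 1 2 3 (far 8 1 0 7
  (split 8 0 (cycle₈ 8 0 6 5 4 3 2 1) (split 8 4 (cycle₈ 8 1 2 3 7 0 6 4) (split 8 5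
  (cycle₈ 8 1 0 7 3 4 6 5) (path (5 ∷ 4 ∷ 3 ∷ 7 ∷ 0 ∷ 1 ∷ 8 ∷ []))))))))
  (path (5 ∷ 4 ∷ 3 ∷ 2 ∷ 1 ∷ 0 ∷ 7 ∷ [])))))))) (expand 0 (far 7 0 1 2 (far 7 0 6 5 (split 7 1
  (cycle₈ 7 0 6 5 4 3 2 1) (split 7 3 (expand 5 (far 8 5 6 0 (far 8 5 4 3 (split 8 1
  (cycle₈ 8 1 2 3 7 0 6 5) (split 8 2 (cycle₈ 8 2 1 0 7 3 4 5) (split 8 4
  (cycle₈ 8 4 3 2 1 0 6 5) (path (0 ∷ 1 ∷ 2 ∷ 3 ∷ 4 ∷ 5 ∷ 8 ∷ [])))))))) (split 7 4 (expand 2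
  (far 8 2 1 0 (far 8 2 3 4 (split 8 1 (cycle₈ 8 1 0 6 5 4 3 2) (split 8 5
  (cycle₈ 8 2 3 4 7 0 6 5) (split 8 6 (cycle₈ 8 2 1 0 7 4 5 6)
  (path (4 ∷ 5 ∷ 6 ∷ 0 ∷ 1 ∷ 2 ∷ 8 ∷ [])))))))) (path (5 ∷ 4 ∷ 3 ∷ 2 ∷ 1 ∷ 0 ∷ 7 ∷ []))))))))))
  -- From here on 6 misses 0, 2 and 3; if it also misses 1 and 4, it prolongs the path.
  (split 6 1 (split 6 4 (expand 5 (far 7 5 6 1 (far 7 5 4 3 (far 7 5 6 4 (split 7 0
  (cycle₈ 7 0 1 2 3 4 6 5) (split 7 2 (expand 0 (far 8 0 1 2 (split 8 3 (cycle₈ 8 0 1 2 7 5 4 3)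
  (split 8 4 (cycle₈ 8 0 1 2 7 5 6 4) (split 8 5 (cycle₈ 8 0 1 2 3 4 6 5) (split 8 1 (expand 0
  (far 9 0 8 1 (far 9 0 1 2 (split 9 3 (cycle₈ 9 0 1 2 7 5 4 3) (split 9 4
  (cycle₈ 9 0 1 2 7 5 6 4) (split 9 5 (cycle₈ 9 0 1 2 3 4 6 5)
  (path (5 ∷ 4 ∷ 3 ∷ 2 ∷ 1 ∷ 0 ∷ 9 ∷ [])))))))) (path (5 ∷ 4 ∷ 3 ∷ 2 ∷ 1 ∷ 0 ∷ 8 ∷ []))))))))
  (path (0 ∷ 1 ∷ 2 ∷ 3 ∷ 4 ∷ 5 ∷ 7 ∷ [])))))))) (expand 3 (far 7 3 2 1 (far 7 3 4 5 (split 7 2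
  (far 7 2 1 0 (far 7 2 3 4 (far 7 2 1 6 (path (0 ∷ 1 ∷ 6 ∷ 5 ∷ 4 ∷ 3 ∷ 7 ∷ []))))) (split 7 6
  (far 7 6 1 0 (far 7 6 5 4 (expand 5 (far 8 5 6 1 (far 8 5 4 3 (far 8 5 6 7 (split 8 0
  (cycle₈ 8 0 1 2 3 7 6 5) (split 8 2 (cycle₈ 8 2 1 6 7 3 4 5) (split 8 4 (far 8 4 5 6
  (path (0 ∷ 1 ∷ 6 ∷ 7 ∷ 3 ∷ 4 ∷ 8 ∷ []))) (path (0 ∷ 1 ∷ 2 ∷ 3 ∷ 4 ∷ 5 ∷ 8 ∷ [])))))))))))
  (split 7 0 (expand 5 (far 8 5 6 1 (far 8 5 4 3 (split 8 0 (cycle₈ 8 0 7 3 2 1 6 5) (split 8 2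
  (cycle₈ 8 2 1 0 7 3 4 5) (split 8 4 (cycle₈ 8 4 3 7 0 1 6 5)
  (path (0 ∷ 1 ∷ 2 ∷ 3 ∷ 4 ∷ 5 ∷ 8 ∷ [])))))))) (split 7 4 (expand 2 (far 8 2 1 0 (far 8 2 3 4
  (far 8 2 1 6 (far 8 2 3 7 (split 8 1 (cycle₈ 8 1 6 5 4 7 3 2) (split 8 5
  (path (0 ∷ 1 ∷ 2 ∷ 8 ∷ 5 ∷ 4 ∷ 7 ∷ [])) (path (7 ∷ 4 ∷ 5 ∷ 6 ∷ 1 ∷ 2 ∷ 8 ∷ [])))))))))
  (path (0 ∷ 1 ∷ 6 ∷ 5 ∷ 4 ∷ 3 ∷ 7 ∷ [])))))))))) (split 6 4 (expand 5 (far 7 5 4 3 (far 7 5 6 4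
  (far 7 5 4 6 (split 7 0 (cycle₈ 7 0 1 2 3 4 6 5) (split 7 1 (split 7 2 (expand 3 (far 8 3 2 1
  (far 8 3 4 5 (far 8 3 2 7 (split 8 0 (cycle₈ 8 0 1 2 7 5 4 3) (split 8 4
  (cycle₈ 8 3 2 1 7 5 6 4) (path (0 ∷ 1 ∷ 7 ∷ 5 ∷ 4 ∷ 3 ∷ 8 ∷ [])))))))) (expand 3 (far 8 3 2 1
  (far 8 3 4 5 (far 8 3 4 6 (split 8 0 (cycle₈ 8 0 1 7 5 6 4 3) (split 8 2
  (cycle₈ 8 2 1 7 5 6 4 3) (split 8 4 (cycle₈ 8 3 2 1 7 5 6 4) (split 8 7
  (path (6 ∷ 4 ∷ 3 ∷ 8 ∷ 7 ∷ 1 ∷ 0 ∷ [])) (path (6 ∷ 5 ∷ 7 ∷ 1 ∷ 2 ∷ 3 ∷ 8 ∷ [])))))))))))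
  (split 7 2 (expand 0 (far 8 0 1 2 (split 8 3 (cycle₈ 8 0 1 2 7 5 4 3) (split 8 4
  (cycle₈ 8 0 1 2 7 5 6 4) (split 8 5 (cycle₈ 8 0 1 2 3 4 6 5) (split 8 1 (expand 0 (far 9 0 8 1
  (far 9 0 1 2 (split 9 3 (cycle₈ 9 0 1 2 7 5 4 3) (split 9 4 (cycle₈ 9 0 1 2 7 5 6 4) (split 9 5
  (cycle₈ 9 0 1 2 3 4 6 5) (path (5 ∷ 4 ∷ 3 ∷ 2 ∷ 1 ∷ 0 ∷ 9 ∷ []))))))))
  (path (5 ∷ 4 ∷ 3 ∷ 2 ∷ 1 ∷ 0 ∷ 8 ∷ [])))))))) (path (0 ∷ 1 ∷ 2 ∷ 3 ∷ 4 ∷ 5 ∷ 7 ∷ [])))))))))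
  (path (0 ∷ 1 ∷ 2 ∷ 3 ∷ 4 ∷ 5 ∷ 6 ∷ [])))))))

certificate8 : Certificate 8
certificate8 =
  -- A neighbour of 0 that sees the other end 6 closes the seven-vertex path to a C₈, and one that
  -- sees 2 closes a C₄. The contacts 3, 1, 4 and 5 of 7 remain.
  expand 0 (far 7 0 1 2 (split 7 6 (cycle₈ 7 0 1 2 3 4 5 6) (split 7 3 (far 7 3 2 1 (far 7 3 4 5
  (split 7 4 (expand 0 (far 8 0 1 2 (far 8 0 7 3 (far 8 0 7 4 (split 8 5 (cycle₈ 8 0 1 2 3 7 4 5)
  (split 8 6 (cycle₈ 8 0 1 2 3 4 5 6) (split 8 1 (expand 2 (far 9 2 1 0 (far 9 2 3 4 (far 9 2 3 7
  (split 9 1 (cycle₈ 9 1 8 0 7 4 3 2) (split 9 5 (cycle₈ 9 2 1 0 7 3 4 5) (split 9 6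
  (cycle₈ 9 2 1 0 7 4 5 6) (path (6 ∷ 5 ∷ 4 ∷ 7 ∷ 0 ∷ 1 ∷ 2 ∷ 9 ∷ [])))))))))
  -- At `expand 7`, vertex 7 sees only 0 and 3 on the path: `0 1 2 3 7` is a C₅ with the tail
  -- `4 5 6` at 3. Both `6 5 4 3 2 1 0` and `6 5 4 3 7 0 1` are induced, and either may be
  -- prolonged.
  (path (6 ∷ 5 ∷ 4 ∷ 3 ∷ 2 ∷ 1 ∷ 0 ∷ 8 ∷ []))))))))) (expand 7 (far 8 7 0 1 (far 8 7 3 2
  (far 8 7 3 4 (split 8 5 (cycle₈ 8 5 4 3 2 1 0 7) (split 8 0 (far 8 0 7 3 (split 8 6
  (cycle₈ 8 0 1 2 3 4 5 6) (path (6 ∷ 5 ∷ 4 ∷ 3 ∷ 2 ∷ 1 ∷ 0 ∷ 8 ∷ [])))) (split 8 6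
  (path (2 ∷ 1 ∷ 0 ∷ 7 ∷ 8 ∷ 6 ∷ 5 ∷ 4 ∷ [])) (split 8 3 (expand 8 (far 9 8 7 0 (far 9 8 3 2
  (far 9 8 7 3 (far 9 8 3 4 (far 9 8 3 7 (split 9 1 (split 9 5 (cycle₈ 9 1 0 7 8 3 4 5)
  (split 9 6 (cycle₈ 9 1 0 7 3 4 5 6) (path (6 ∷ 5 ∷ 4 ∷ 3 ∷ 7 ∷ 0 ∷ 1 ∷ 9 ∷ [])))) (split 9 5
  (path (2 ∷ 1 ∷ 0 ∷ 7 ∷ 8 ∷ 9 ∷ 5 ∷ 4 ∷ [])) (split 9 6
  (path (0 ∷ 1 ∷ 2 ∷ 3 ∷ 4 ∷ 5 ∷ 6 ∷ 9 ∷ [])) (expand 0 (far 10 0 1 2 (far 10 0 7 3 (far 10 0 7 8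
  (split 10 6 (cycle₈ 10 0 1 2 3 4 5 6) (split 10 9 (cycle₈ 10 0 1 2 3 7 8 9) (split 10 7
  (far 10 7 0 1 (far 10 7 3 4 (split 10 5 (cycle₈ 10 5 4 3 2 1 0 7)
  (path (6 ∷ 5 ∷ 4 ∷ 3 ∷ 2 ∷ 1 ∷ 0 ∷ 10 ∷ []))))) (split 10 1 (expand 2 (far 11 2 1 0
  (far 11 2 3 7 (far 11 2 3 8 (split 11 1 (cycle₈ 11 1 10 0 7 8 3 2) (split 11 9
  -- From `expand 9` on, the induced path `11 2 1 0 7 8 9` takes over. Contacts of a new neighbour
  -- of 9 with it close a C₄ or a C₈, partly by detours through 3 or 10, except for the triangle on
  -- 8 and 9.
  (cycle₈ 11 2 1 0 7 3 8 9) (expand 9 (far 12 9 8 7 (split 12 0 (cycle₈ 12 0 1 2 3 7 8 9)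
  (split 12 1 (cycle₈ 12 1 10 0 7 3 8 9) (split 12 2 (cycle₈ 12 2 1 0 7 3 8 9) (split 12 11
  (cycle₈ 12 9 8 7 0 1 2 11) (split 12 8 (expand 9 (far 13 9 8 7 (far 13 9 12 8 (split 13 0
  (cycle₈ 13 0 1 2 3 7 8 9) (split 13 1 (cycle₈ 13 1 0 7 3 8 12 9) (split 13 2
  (cycle₈ 13 2 1 0 7 3 8 9) (split 13 11 (cycle₈ 13 9 8 7 0 1 2 11)
  (path (11 ∷ 2 ∷ 1 ∷ 0 ∷ 7 ∷ 8 ∷ 9 ∷ 13 ∷ [])))))))))
  (path (11 ∷ 2 ∷ 1 ∷ 0 ∷ 7 ∷ 8 ∷ 9 ∷ 12 ∷ []))))))))))))))) (split 10 5
  (path (8 ∷ 3 ∷ 2 ∷ 1 ∷ 0 ∷ 10 ∷ 5 ∷ 6 ∷ [])) (split 10 4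
  (path (9 ∷ 8 ∷ 7 ∷ 0 ∷ 10 ∷ 4 ∷ 5 ∷ 6 ∷ []))
  (path (6 ∷ 5 ∷ 4 ∷ 3 ∷ 2 ∷ 1 ∷ 0 ∷ 10 ∷ []))))))))))))))))))))) (expand 1 (far 9 1 2 3
  (far 9 1 0 7 (split 9 6 (cycle₈ 9 1 0 7 3 4 5 6) (split 9 0 (far 9 0 1 2 (far 9 0 7 8
  (split 9 5 (path (8 ∷ 7 ∷ 3 ∷ 2 ∷ 1 ∷ 9 ∷ 5 ∷ 6 ∷ [])) (split 9 4 (expand 6 (far 10 6 5 4
  (split 10 0 (cycle₈ 10 0 1 2 3 4 5 6) (split 10 1 (cycle₈ 10 1 0 7 3 4 5 6) (split 10 2
  (cycle₈ 10 2 1 0 9 4 5 6) (split 10 3 (cycle₈ 10 3 2 1 9 4 5 6) (split 10 5 (expand 6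
  (far 11 6 5 4 (far 11 6 10 5 (split 11 0 (cycle₈ 11 0 1 2 3 4 5 6) (split 11 1
  (cycle₈ 11 1 0 7 3 4 5 6) (split 11 2 (cycle₈ 11 2 1 0 9 4 5 6) (split 11 3
  (cycle₈ 11 3 2 1 9 4 5 6) (path (0 ∷ 1 ∷ 2 ∷ 3 ∷ 4 ∷ 5 ∷ 6 ∷ 11 ∷ [])))))))))
  (path (0 ∷ 1 ∷ 2 ∷ 3 ∷ 4 ∷ 5 ∷ 6 ∷ 10 ∷ []))))))))) (expand 9 (far 10 9 1 0 (far 10 9 0 1
  (far 10 9 1 2 (far 10 9 0 7 (split 10 5 (cycle₈ 10 5 4 3 2 1 0 9) (split 10 6
  (cycle₈ 10 6 5 4 3 2 1 9) (split 10 8 (cycle₈ 10 8 7 3 2 1 0 9) (split 10 4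
  (path (8 ∷ 7 ∷ 0 ∷ 9 ∷ 10 ∷ 4 ∷ 5 ∷ 6 ∷ [])) (split 10 3 (expand 2 (far 11 2 1 0 (far 11 2 3 4
  (far 11 2 3 7 (far 11 2 1 9 (far 11 2 3 10 (split 11 5 (cycle₈ 11 2 1 0 7 3 4 5) (split 11 8
  (cycle₈ 11 2 1 9 10 3 7 8) (split 11 1 (far 11 1 2 3 (split 11 6 (cycle₈ 11 1 0 7 3 4 5 6)
  (path (6 ∷ 5 ∷ 4 ∷ 3 ∷ 7 ∷ 0 ∷ 1 ∷ 11 ∷ [])))) (split 11 6
  (path (7 ∷ 0 ∷ 1 ∷ 2 ∷ 11 ∷ 6 ∷ 5 ∷ 4 ∷ [])) (split 11 3 (expand 10 (far 12 10 3 11 (split 12 8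
  (cycle₈ 12 8 7 0 1 2 3 10) (expand 11 (far 13 11 2 1 (far 13 11 3 2 (far 13 11 3 7 (split 13 0
  (cycle₈ 13 0 1 9 10 3 2 11) (split 13 8 (cycle₈ 13 8 7 0 1 2 3 11) (expand 8 (far 14 8 7 0
  (split 14 1 (cycle₈ 14 1 0 9 10 3 7 8) (split 14 2 (cycle₈ 14 2 1 9 10 3 7 8) (split 14 11
  (cycle₈ 14 8 7 0 1 2 3 11) (split 14 13 (cycle₈ 14 8 7 0 1 2 11 13) (split 14 7 (expand 8
  (far 15 8 7 0 (far 15 8 14 7 (split 15 1 (cycle₈ 15 1 0 9 10 3 7 8) (split 15 2
  (cycle₈ 15 2 1 9 0 7 14 8) (split 15 11 (cycle₈ 15 8 7 0 1 2 3 11) (split 15 13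
  (cycle₈ 15 8 7 0 1 2 11 13) (path (13 ∷ 11 ∷ 2 ∷ 1 ∷ 0 ∷ 7 ∷ 8 ∷ 15 ∷ [])))))))))
  (path (13 ∷ 11 ∷ 2 ∷ 1 ∷ 0 ∷ 7 ∷ 8 ∷ 14 ∷ [])))))))))))))))))) (expand 6 (far 12 6 5 4
  (split 12 0 (cycle₈ 12 0 1 2 3 4 5 6) (split 12 1 (cycle₈ 12 1 0 7 3 4 5 6) (split 12 9
  (cycle₈ 12 6 5 4 3 2 1 9) (split 12 3 (far 12 3 4 5 (far 12 3 7 8 (far 12 3 2 11 (split 12 2
  (far 12 2 3 7 (path (7 ∷ 0 ∷ 1 ∷ 2 ∷ 12 ∷ 6 ∷ 5 ∷ 4 ∷ []))) (expand 5 (far 13 5 4 3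
  (far 13 5 6 12 (split 13 0 (cycle₈ 13 0 1 2 3 12 6 5) (split 13 1 (cycle₈ 13 1 0 7 3 12 6 5)
  (split 13 2 (cycle₈ 13 2 1 0 7 3 4 5) (split 13 7 (cycle₈ 13 5 4 3 2 1 0 7) (split 13 9
  (cycle₈ 13 5 4 3 2 1 0 9) (split 13 10 (cycle₈ 13 5 4 3 2 1 9 10) (split 13 6 (far 13 6 5 4
  (split 13 8 (path (0 ∷ 1 ∷ 2 ∷ 3 ∷ 4 ∷ 5 ∷ 13 ∷ 8 ∷ [])) (split 13 11
  (path (1 ∷ 0 ∷ 7 ∷ 3 ∷ 4 ∷ 5 ∷ 13 ∷ 11 ∷ [])) (expand 13 (far 14 13 5 4 (split 14 8
  (cycle₈ 14 8 7 3 4 5 6 13) (split 14 11 (cycle₈ 14 11 2 3 4 5 6 13) (expand 4 (split 15 8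
  -- From `expand 8` on, the induced path `8 7 0 1 2 11` takes over; one vertex is gained at each of
  -- its ends, with the triangle pattern at both.
  (cycle₈ 15 4 3 2 1 0 7 8) (split 15 11 (cycle₈ 15 4 3 7 0 1 2 11) (expand 8 (far 16 8 7 0
  (split 16 1 (cycle₈ 16 1 0 9 10 3 7 8) (split 16 2 (cycle₈ 16 2 1 9 10 3 7 8) (split 16 11
  (cycle₈ 16 8 7 0 9 1 2 11) (split 16 7 (expand 8 (far 17 8 7 0 (far 17 8 16 7 (split 17 1
  (cycle₈ 17 1 0 9 10 3 7 8) (split 17 2 (cycle₈ 17 2 1 9 0 7 16 8) (split 17 11
  (cycle₈ 17 8 7 0 9 1 2 11) (expand 11 (far 18 11 2 1 (split 18 0 (cycle₈ 18 0 1 9 10 3 2 11)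
  (split 18 7 (cycle₈ 18 7 0 9 10 3 2 11) (split 18 8 (cycle₈ 18 8 7 0 9 1 2 11) (split 18 17
  (cycle₈ 18 11 2 1 0 7 8 17) (split 18 2 (expand 11 (far 19 11 2 1 (far 19 11 18 2 (split 19 0
  (cycle₈ 19 0 1 9 10 3 2 11) (split 19 7 (cycle₈ 19 7 0 9 1 2 18 11) (split 19 8
  (cycle₈ 19 8 7 0 1 2 18 11) (split 19 17 (cycle₈ 19 11 2 1 0 7 8 17)
  (path (17 ∷ 8 ∷ 7 ∷ 0 ∷ 1 ∷ 2 ∷ 11 ∷ 19 ∷ [])))))))))
  (path (17 ∷ 8 ∷ 7 ∷ 0 ∷ 1 ∷ 2 ∷ 11 ∷ 18 ∷ []))))))))))))))) (expand 11 (far 17 11 2 1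
  (split 17 0 (cycle₈ 17 0 1 9 10 3 2 11) (split 17 7 (cycle₈ 17 7 0 9 10 3 2 11) (split 17 8
  (cycle₈ 17 8 7 0 9 1 2 11) (split 17 16 (cycle₈ 17 11 2 1 0 7 8 16) (split 17 2 (expand 11
  (far 18 11 2 1 (far 18 11 17 2 (split 18 0 (cycle₈ 18 0 1 9 10 3 2 11) (split 18 7
  (cycle₈ 18 7 0 9 1 2 17 11) (split 18 8 (cycle₈ 18 8 7 0 1 2 17 11) (split 18 16
  (cycle₈ 18 11 2 1 0 7 8 16) (path (16 ∷ 8 ∷ 7 ∷ 0 ∷ 1 ∷ 2 ∷ 11 ∷ 18 ∷ [])))))))))
  (path (16 ∷ 8 ∷ 7 ∷ 0 ∷ 1 ∷ 2 ∷ 11 ∷ 17 ∷ [])))))))))))))))))))))))))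
  (path (0 ∷ 1 ∷ 2 ∷ 3 ∷ 12 ∷ 6 ∷ 5 ∷ 13 ∷ [])))))))))))))))) (split 12 2 (far 12 2 3 7
  (split 12 5 (cycle₈ 12 2 1 0 7 3 4 5) (path (7 ∷ 0 ∷ 1 ∷ 2 ∷ 12 ∷ 6 ∷ 5 ∷ 4 ∷ []))))
  (split 12 5 (split 12 7 (cycle₈ 12 5 4 3 2 1 0 7) (split 12 10 (cycle₈ 12 5 4 3 2 1 9 10)
  (split 12 8 (path (0 ∷ 1 ∷ 2 ∷ 3 ∷ 4 ∷ 5 ∷ 12 ∷ 8 ∷ [])) (split 12 11
  (path (1 ∷ 0 ∷ 7 ∷ 3 ∷ 4 ∷ 5 ∷ 12 ∷ 11 ∷ [])) (expand 6 (far 13 6 5 4 (far 13 6 5 12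
  (split 13 8 (cycle₈ 13 6 12 5 4 3 7 8) (split 13 11 (cycle₈ 13 6 12 5 4 3 2 11) (expand 12
  (far 14 12 5 4 (split 14 8 (cycle₈ 14 8 7 3 4 5 6 12) (split 14 11 (cycle₈ 14 11 2 3 4 5 6 12)
  (expand 4 (split 15 8 (cycle₈ 15 4 3 2 1 0 7 8) (split 15 11 (cycle₈ 15 4 3 7 0 1 2 11)
  (expand 8 (far 16 8 7 0 (split 16 1 (cycle₈ 16 1 0 9 10 3 7 8) (split 16 2
  (cycle₈ 16 2 1 9 10 3 7 8) (split 16 11 (cycle₈ 16 8 7 0 9 1 2 11) (split 16 7 (expand 8
  (far 17 8 7 0 (far 17 8 16 7 (split 17 1 (cycle₈ 17 1 0 9 10 3 7 8) (split 17 2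
  (cycle₈ 17 2 1 9 0 7 16 8) (split 17 11 (cycle₈ 17 8 7 0 9 1 2 11) (expand 11 (far 18 11 2 1
  (split 18 0 (cycle₈ 18 0 1 9 10 3 2 11) (split 18 7 (cycle₈ 18 7 0 9 10 3 2 11) (split 18 8
  (cycle₈ 18 8 7 0 9 1 2 11) (split 18 17 (cycle₈ 18 11 2 1 0 7 8 17) (split 18 2 (expand 11
  (far 19 11 2 1 (far 19 11 18 2 (split 19 0 (cycle₈ 19 0 1 9 10 3 2 11) (split 19 7
  (cycle₈ 19 7 0 9 1 2 18 11) (split 19 8 (cycle₈ 19 8 7 0 1 2 18 11) (split 19 17
  (cycle₈ 19 11 2 1 0 7 8 17) (path (17 ∷ 8 ∷ 7 ∷ 0 ∷ 1 ∷ 2 ∷ 11 ∷ 19 ∷ [])))))))))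
  (path (17 ∷ 8 ∷ 7 ∷ 0 ∷ 1 ∷ 2 ∷ 11 ∷ 18 ∷ []))))))))))))))) (expand 11 (far 17 11 2 1
  (split 17 0 (cycle₈ 17 0 1 9 10 3 2 11) (split 17 7 (cycle₈ 17 7 0 9 10 3 2 11) (split 17 8
  (cycle₈ 17 8 7 0 9 1 2 11) (split 17 16 (cycle₈ 17 11 2 1 0 7 8 16) (split 17 2 (expand 11
  (far 18 11 2 1 (far 18 11 17 2 (split 18 0 (cycle₈ 18 0 1 9 10 3 2 11) (split 18 7
  (cycle₈ 18 7 0 9 1 2 17 11) (split 18 8 (cycle₈ 18 8 7 0 1 2 17 11) (split 18 16
  (cycle₈ 18 11 2 1 0 7 8 16) (path (16 ∷ 8 ∷ 7 ∷ 0 ∷ 1 ∷ 2 ∷ 11 ∷ 18 ∷ [])))))))))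
  (path (16 ∷ 8 ∷ 7 ∷ 0 ∷ 1 ∷ 2 ∷ 11 ∷ 17 ∷ [])))))))))))))))))))))))))))))))
  (path (0 ∷ 1 ∷ 2 ∷ 3 ∷ 4 ∷ 5 ∷ 6 ∷ 12 ∷ [])))))))))))))))))))))
  (path (6 ∷ 5 ∷ 4 ∷ 3 ∷ 7 ∷ 0 ∷ 9 ∷ 10 ∷ [])))))))))))))))) (split 9 2 (far 9 2 3 4 (split 9 5
  (cycle₈ 9 2 1 0 7 3 4 5) (path (6 ∷ 5 ∷ 4 ∷ 3 ∷ 7 ∷ 0 ∷ 1 ∷ 9 ∷ [])))) (split 9 4 (split 9 8
  (cycle₈ 9 4 3 2 1 0 7 8) (split 9 5 (path (8 ∷ 7 ∷ 3 ∷ 2 ∷ 1 ∷ 9 ∷ 5 ∷ 6 ∷ []))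
  (path (8 ∷ 7 ∷ 0 ∷ 1 ∷ 9 ∷ 4 ∷ 5 ∷ 6 ∷ [])))) (split 9 5 (split 9 8 (expand 0 (far 10 0 1 2
  (far 10 0 7 3 (split 10 1 (cycle₈ 10 0 7 3 4 5 9 1) (split 10 4 (cycle₈ 10 0 1 9 8 7 3 4)
  (split 10 5 (cycle₈ 10 0 7 3 2 1 9 5) (split 10 6 (cycle₈ 10 0 1 2 3 4 5 6)
  (path (6 ∷ 5 ∷ 4 ∷ 3 ∷ 2 ∷ 1 ∷ 0 ∷ 10 ∷ [])))))))))
  (path (8 ∷ 7 ∷ 3 ∷ 2 ∷ 1 ∷ 9 ∷ 5 ∷ 6 ∷ [])))
  (path (6 ∷ 5 ∷ 4 ∷ 3 ∷ 7 ∷ 0 ∷ 1 ∷ 9 ∷ []))))))))))))))))))))) (split 7 1 (split 7 4 (expand 0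
  (far 8 0 7 1 (far 8 0 1 2 (far 8 0 7 4 (split 8 5 (cycle₈ 8 0 7 1 2 3 4 5) (split 8 6
  (cycle₈ 8 0 1 2 3 4 5 6) (split 8 3 (expand 6 (far 9 6 5 4 (split 9 0 (cycle₈ 9 0 1 2 3 4 5 6)
  (split 9 1 (cycle₈ 9 1 0 8 3 4 5 6) (split 9 2 (cycle₈ 9 2 1 0 7 4 5 6) (split 9 3
  (cycle₈ 9 3 2 1 7 4 5 6) (split 9 5 (expand 6 (far 10 6 5 4 (far 10 6 9 5 (split 10 0
  (cycle₈ 10 0 1 2 3 4 5 6) (split 10 1 (cycle₈ 10 1 0 7 4 5 9 6) (split 10 2
  (cycle₈ 10 2 1 0 7 4 5 6) (split 10 3 (cycle₈ 10 3 2 1 7 4 5 6)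
  (path (0 ∷ 1 ∷ 2 ∷ 3 ∷ 4 ∷ 5 ∷ 6 ∷ 10 ∷ [])))))))))
  (path (0 ∷ 1 ∷ 2 ∷ 3 ∷ 4 ∷ 5 ∷ 6 ∷ 9 ∷ [])))))))))
  (path (6 ∷ 5 ∷ 4 ∷ 3 ∷ 2 ∷ 1 ∷ 0 ∷ 8 ∷ []))))))))) (split 7 5 (expand 0 (far 8 0 7 1
  (far 8 0 1 2 (far 8 0 7 5 (far 8 0 1 7 (split 8 6 (cycle₈ 8 0 1 2 3 4 5 6) (split 8 3 (expand 2
  (far 9 2 1 0 (far 9 2 1 7 (far 9 2 3 8 (split 9 3 (cycle₈ 9 2 1 0 7 5 4 3) (split 9 5
  (cycle₈ 9 2 1 0 8 3 4 5) (split 9 6 (cycle₈ 9 2 3 8 0 7 5 6)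
  (path (6 ∷ 5 ∷ 7 ∷ 0 ∷ 8 ∷ 3 ∷ 2 ∷ 9 ∷ []))))))))) (split 8 4 (expand 2 (far 9 2 1 0
  (far 9 2 3 4 (split 9 1 (cycle₈ 9 1 0 7 5 4 3 2) (split 9 5 (cycle₈ 9 2 1 7 0 8 4 5) (split 9 6
  (cycle₈ 9 2 1 0 8 4 5 6) (split 9 8 (cycle₈ 9 2 1 0 7 5 4 8)
  (path (6 ∷ 5 ∷ 4 ∷ 8 ∷ 0 ∷ 1 ∷ 2 ∷ 9 ∷ [])))))))))
  -- At `expand 0`, the triangle `0 7 1` lengthens cycles by one: a contact of 8 with 5 closes a C₇
  -- along the path, and the detour through 7 makes it a C₈.
  (path (6 ∷ 5 ∷ 4 ∷ 3 ∷ 2 ∷ 1 ∷ 0 ∷ 8 ∷ [])))))))))) (expand 0 (far 8 0 7 1 (far 8 0 1 2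
  (far 8 0 1 7 (split 8 5 (cycle₈ 8 0 7 1 2 3 4 5) (split 8 6 (cycle₈ 8 0 1 2 3 4 5 6) (split 8 3
  (split 8 4 (expand 2 (far 9 2 1 0 (far 9 2 3 4 (far 9 2 3 8 (split 9 1 (cycle₈ 9 1 7 0 8 4 3 2)
  (split 9 5 (cycle₈ 9 2 1 0 8 3 4 5) (split 9 6 (cycle₈ 9 2 1 0 8 4 5 6)
  (path (6 ∷ 5 ∷ 4 ∷ 8 ∷ 0 ∷ 1 ∷ 2 ∷ 9 ∷ []))))))))) (expand 2 (far 9 2 1 0 (far 9 2 3 4
  (far 9 2 1 7 (far 9 2 3 8 (split 9 5 (cycle₈ 9 2 1 0 8 3 4 5) (split 9 1 (far 9 1 2 3
  (split 9 6 (cycle₈ 9 1 0 8 3 4 5 6) (path (6 ∷ 5 ∷ 4 ∷ 3 ∷ 8 ∷ 0 ∷ 1 ∷ 9 ∷ [])))) (split 9 6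
  (path (8 ∷ 0 ∷ 1 ∷ 2 ∷ 9 ∷ 6 ∷ 5 ∷ 4 ∷ [])) (split 9 3 (expand 7 (far 10 7 1 0 (far 10 7 0 1
  (far 10 7 1 2 (far 10 7 0 8 (split 10 4 (cycle₈ 10 4 3 9 2 1 0 7) (split 10 5
  (cycle₈ 10 5 4 3 2 1 0 7) (split 10 6 (cycle₈ 10 6 5 4 3 2 1 7) (split 10 9
  (cycle₈ 10 7 1 0 8 3 2 9) (split 10 3 (expand 8 (far 11 8 0 1 (far 11 8 3 2 (far 11 8 3 4
  (far 11 8 0 7 (far 11 8 3 9 (far 11 8 3 10 (split 11 0 (cycle₈ 11 0 7 1 2 9 3 8) (split 11 3
  (cycle₈ 11 3 9 2 1 7 0 8) (split 11 5 (cycle₈ 11 5 4 3 2 1 0 8) (split 11 6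
  (path (0 ∷ 1 ∷ 2 ∷ 3 ∷ 4 ∷ 5 ∷ 6 ∷ 11 ∷ [])) (expand 9 (far 12 9 2 1 (far 12 9 3 2
  (far 12 9 3 8 (far 12 9 3 10 (split 12 0 (cycle₈ 12 0 1 7 10 3 2 9) (split 12 11
  (cycle₈ 12 9 2 1 7 0 8 11) (expand 10 (split 13 11 (cycle₈ 13 10 3 2 1 0 8 11) (expand 11
  (far 14 11 8 0 (split 14 1 (cycle₈ 14 1 0 7 10 3 8 11) (split 14 2 (cycle₈ 14 2 1 7 10 3 8 11)
  (split 14 9 (cycle₈ 14 9 2 1 7 0 8 11) (split 14 12 (cycle₈ 14 11 8 0 1 2 9 12) (split 14 8
  (expand 11 (far 15 11 8 0 (far 15 11 14 8 (split 15 1 (cycle₈ 15 1 0 7 10 3 8 11) (split 15 2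
  (cycle₈ 15 2 1 7 0 8 14 11) (split 15 9 (cycle₈ 15 9 2 1 0 8 14 11) (split 15 12
  (cycle₈ 15 11 8 0 1 2 9 12) (path (12 ∷ 9 ∷ 2 ∷ 1 ∷ 0 ∷ 8 ∷ 11 ∷ 15 ∷ [])))))))))
  (path (12 ∷ 9 ∷ 2 ∷ 1 ∷ 0 ∷ 8 ∷ 11 ∷ 14 ∷ [])))))))))))))))))))))))))))))
  (path (6 ∷ 5 ∷ 4 ∷ 3 ∷ 8 ∷ 0 ∷ 7 ∷ 10 ∷ [])))))))))))) (expand 7 (far 10 7 1 0 (far 10 7 0 1
  (far 10 7 1 2 (far 10 7 0 8 (split 10 5 (cycle₈ 10 5 4 3 2 1 0 7) (split 10 6
  (cycle₈ 10 6 5 4 3 2 1 7) (split 10 9 (cycle₈ 10 7 1 0 8 3 2 9) (split 10 4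
  (path (9 ∷ 2 ∷ 1 ∷ 7 ∷ 10 ∷ 4 ∷ 5 ∷ 6 ∷ [])) (split 10 3 (expand 6 (far 11 6 5 4 (split 11 0
  (cycle₈ 11 0 1 2 3 4 5 6) (split 11 1 (cycle₈ 11 1 0 8 3 4 5 6) (split 11 7
  (cycle₈ 11 6 5 4 3 2 1 7) (split 11 2 (far 11 2 3 8 (split 11 5 (cycle₈ 11 2 1 0 8 3 4 5)
  (path (8 ∷ 0 ∷ 1 ∷ 2 ∷ 11 ∷ 6 ∷ 5 ∷ 4 ∷ [])))) (split 11 3 (far 11 3 4 5 (far 11 3 2 9
  (split 11 8 (path (2 ∷ 1 ∷ 0 ∷ 8 ∷ 11 ∷ 6 ∷ 5 ∷ 4 ∷ [])) (split 11 10
  (path (8 ∷ 0 ∷ 7 ∷ 10 ∷ 11 ∷ 6 ∷ 5 ∷ 4 ∷ [])) (expand 5 (far 12 5 4 3 (far 12 5 6 11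
  (split 12 0 (cycle₈ 12 0 1 2 3 11 6 5) (split 12 1 (cycle₈ 12 1 0 7 10 3 4 5) (split 12 2
  (cycle₈ 12 2 1 0 8 3 4 5) (split 12 7 (cycle₈ 12 5 4 3 2 1 0 7) (split 12 8
  (cycle₈ 12 5 4 3 2 1 0 8) (split 12 10 (cycle₈ 12 5 4 3 2 1 7 10) (split 12 6 (far 12 6 5 4
  (split 12 9 (path (1 ∷ 0 ∷ 8 ∷ 3 ∷ 4 ∷ 5 ∷ 12 ∷ 9 ∷ [])) (expand 12 (far 13 12 5 4
  (far 13 12 6 5 (split 13 0 (cycle₈ 13 0 1 2 3 4 5 12) (split 13 1 (cycle₈ 13 1 0 8 3 4 5 12)
  (split 13 7 (cycle₈ 13 7 0 8 3 4 5 12) (split 13 9 (cycle₈ 13 9 2 3 4 5 6 12) (split 13 2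
  (far 13 2 3 8 (path (8 ∷ 0 ∷ 1 ∷ 2 ∷ 13 ∷ 12 ∷ 5 ∷ 4 ∷ []))) (split 13 3 (split 13 8
  (path (2 ∷ 1 ∷ 0 ∷ 8 ∷ 13 ∷ 12 ∷ 5 ∷ 4 ∷ [])) (split 13 10
  (path (8 ∷ 0 ∷ 7 ∷ 10 ∷ 13 ∷ 12 ∷ 5 ∷ 4 ∷ [])) (expand 4 (far 14 4 3 8 (far 14 4 3 10
  (split 14 9 (cycle₈ 14 4 3 8 0 1 2 9) (expand 8 (far 15 8 0 1 (far 15 8 3 2 (far 15 8 3 4
  (far 15 8 0 7 (far 15 8 3 10 (far 15 8 3 11 (far 15 8 3 13 (split 15 5
  (cycle₈ 15 5 4 3 2 1 0 8) (split 15 6 (cycle₈ 15 6 11 3 2 1 0 8) (split 15 9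
  (cycle₈ 15 8 0 7 10 3 2 9) (split 15 12 (cycle₈ 15 8 0 1 2 3 13 12) (split 15 14
  (cycle₈ 15 8 0 1 2 3 4 14) (split 15 0 (far 15 0 8 3
  -- Once 15 misses 0, the induced path `9 2 1 0 8 15` takes over and gains a vertex at either end.
  -- If 15 sees 3, the triangle `3 8 15` already keeps a new neighbour of 15 from seeing 8.
  (path (6 ∷ 5 ∷ 4 ∷ 3 ∷ 2 ∷ 1 ∷ 0 ∷ 15 ∷ []))) (split 15 3 (expand 10 (far 16 10 3 15
  (split 16 9 (cycle₈ 16 9 2 1 0 8 3 10) (expand 15 (far 17 15 8 0 (far 17 15 3 2 (far 17 15 3 8
  (split 17 1 (cycle₈ 17 1 0 7 10 3 8 15) (split 17 9 (cycle₈ 17 9 2 1 0 8 3 15) (expand 9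
  (far 18 9 2 1 (split 18 0 (cycle₈ 18 0 1 7 10 3 2 9) (split 18 8 (cycle₈ 18 8 0 7 10 3 2 9)
  (split 18 15 (cycle₈ 18 9 2 1 0 8 3 15) (split 18 17 (cycle₈ 18 9 2 1 0 8 15 17) (split 18 2
  (expand 9 (far 19 9 2 1 (far 19 9 18 2 (split 19 0 (cycle₈ 19 0 1 7 10 3 2 9) (split 19 8
  (cycle₈ 19 8 0 7 1 2 18 9) (split 19 15 (cycle₈ 19 9 2 1 0 8 3 15) (split 19 17
  (cycle₈ 19 9 2 1 0 8 15 17) (path (17 ∷ 15 ∷ 8 ∷ 0 ∷ 1 ∷ 2 ∷ 9 ∷ 19 ∷ [])))))))))
  (path (17 ∷ 15 ∷ 8 ∷ 0 ∷ 1 ∷ 2 ∷ 9 ∷ 18 ∷ [])))))))))))))))))) (expand 9 (far 16 9 2 1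
  (split 16 0 (cycle₈ 16 0 1 7 10 3 2 9) (split 16 8 (cycle₈ 16 8 0 7 10 3 2 9) (split 16 15
  (cycle₈ 16 9 2 1 7 0 8 15) (split 16 2 (expand 9 (far 17 9 2 1 (far 17 9 16 2 (split 17 0
  (cycle₈ 17 0 1 7 10 3 2 9) (split 17 8 (cycle₈ 17 8 0 7 1 2 16 9) (split 17 15
  (cycle₈ 17 9 2 1 7 0 8 15) (expand 15 (far 18 15 8 0 (split 18 1 (cycle₈ 18 1 0 7 10 3 8 15)
  (split 18 2 (cycle₈ 18 2 1 7 10 3 8 15) (split 18 9 (cycle₈ 18 9 2 1 7 0 8 15) (split 18 17
  (cycle₈ 18 15 8 0 1 2 9 17) (split 18 8 (expand 15 (far 19 15 8 0 (far 19 15 18 8 (split 19 1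
  (cycle₈ 19 1 0 7 10 3 8 15) (split 19 2 (cycle₈ 19 2 1 7 0 8 18 15) (split 19 9
  (cycle₈ 19 9 2 1 0 8 18 15) (split 19 17 (cycle₈ 19 15 8 0 1 2 9 17)
  (path (17 ∷ 9 ∷ 2 ∷ 1 ∷ 0 ∷ 8 ∷ 15 ∷ 19 ∷ [])))))))))
  (path (17 ∷ 9 ∷ 2 ∷ 1 ∷ 0 ∷ 8 ∷ 15 ∷ 18 ∷ []))))))))))))))) (expand 15 (far 17 15 8 0
  (split 17 1 (cycle₈ 17 1 0 7 10 3 8 15) (split 17 2 (cycle₈ 17 2 1 7 10 3 8 15) (split 17 9
  (cycle₈ 17 9 2 1 7 0 8 15) (split 17 16 (cycle₈ 17 15 8 0 1 2 9 16) (split 17 8 (expand 15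
  (far 18 15 8 0 (far 18 15 17 8 (split 18 1 (cycle₈ 18 1 0 7 10 3 8 15) (split 18 2
  (cycle₈ 18 2 1 7 0 8 17 15) (split 18 9 (cycle₈ 18 9 2 1 0 8 17 15) (split 18 16
  (cycle₈ 18 15 8 0 1 2 9 16) (path (16 ∷ 9 ∷ 2 ∷ 1 ∷ 0 ∷ 8 ∷ 15 ∷ 18 ∷ [])))))))))
  (path (16 ∷ 9 ∷ 2 ∷ 1 ∷ 0 ∷ 8 ∷ 15 ∷ 17 ∷ []))))))))))))))))))))))))))))))))))))
  (path (0 ∷ 1 ∷ 2 ∷ 3 ∷ 4 ∷ 5 ∷ 12 ∷ 13 ∷ [])))))))))))))
  (path (0 ∷ 1 ∷ 2 ∷ 3 ∷ 11 ∷ 6 ∷ 5 ∷ 12 ∷ [])))))))))))))))) (split 11 5 (split 11 8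
  (cycle₈ 11 5 4 3 2 1 0 8) (split 11 10 (cycle₈ 11 5 4 3 2 1 7 10) (split 11 9
  (path (1 ∷ 0 ∷ 8 ∷ 3 ∷ 4 ∷ 5 ∷ 11 ∷ 9 ∷ [])) (expand 6 (far 12 6 5 4 (far 12 6 11 5
  (far 12 6 5 11 (split 12 0 (cycle₈ 12 0 1 2 3 4 5 6) (split 12 1 (cycle₈ 12 1 0 8 3 4 5 6)
  (split 12 7 (cycle₈ 12 6 5 4 3 2 1 7) (split 12 9 (cycle₈ 12 6 11 5 4 3 2 9) (split 12 2
  (far 12 2 3 8 (path (8 ∷ 0 ∷ 1 ∷ 2 ∷ 12 ∷ 6 ∷ 5 ∷ 4 ∷ []))) (split 12 3 (split 12 8
  (path (2 ∷ 1 ∷ 0 ∷ 8 ∷ 12 ∷ 6 ∷ 5 ∷ 4 ∷ [])) (split 12 10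
  (path (8 ∷ 0 ∷ 7 ∷ 10 ∷ 12 ∷ 6 ∷ 5 ∷ 4 ∷ [])) (expand 11 (far 13 11 5 4 (far 13 11 6 5
  (split 13 0 (cycle₈ 13 0 1 2 3 4 5 11) (split 13 1 (cycle₈ 13 1 0 8 3 4 5 11) (split 13 7
  (cycle₈ 13 7 0 8 3 4 5 11) (split 13 9 (cycle₈ 13 9 2 3 4 5 6 11) (split 13 2 (far 13 2 3 8
  (path (8 ∷ 0 ∷ 1 ∷ 2 ∷ 13 ∷ 11 ∷ 5 ∷ 4 ∷ []))) (split 13 3 (split 13 8
  (path (2 ∷ 1 ∷ 0 ∷ 8 ∷ 13 ∷ 11 ∷ 5 ∷ 4 ∷ [])) (split 13 10
  (path (8 ∷ 0 ∷ 7 ∷ 10 ∷ 13 ∷ 11 ∷ 5 ∷ 4 ∷ [])) (expand 4 (far 14 4 3 8 (far 14 4 3 10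
  (split 14 9 (cycle₈ 14 4 3 8 0 1 2 9) (expand 8 (far 15 8 0 1 (far 15 8 3 2 (far 15 8 3 4
  (far 15 8 0 7 (far 15 8 3 10 (far 15 8 3 12 (far 15 8 3 13 (split 15 5
  (cycle₈ 15 5 4 3 2 1 0 8) (split 15 6 (cycle₈ 15 6 12 3 2 1 0 8) (split 15 9
  (cycle₈ 15 8 0 7 10 3 2 9) (split 15 11 (cycle₈ 15 8 0 1 2 3 13 11) (split 15 14
  (cycle₈ 15 8 0 1 2 3 4 14) (split 15 0 (far 15 0 8 3
  (path (6 ∷ 5 ∷ 4 ∷ 3 ∷ 2 ∷ 1 ∷ 0 ∷ 15 ∷ []))) (split 15 3 (expand 10 (far 16 10 3 15
  (split 16 9 (cycle₈ 16 9 2 1 0 8 3 10) (expand 15 (far 17 15 8 0 (far 17 15 3 2 (far 17 15 3 8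
  (split 17 1 (cycle₈ 17 1 0 7 10 3 8 15) (split 17 9 (cycle₈ 17 9 2 1 0 8 3 15) (expand 9
  (far 18 9 2 1 (split 18 0 (cycle₈ 18 0 1 7 10 3 2 9) (split 18 8 (cycle₈ 18 8 0 7 10 3 2 9)
  (split 18 15 (cycle₈ 18 9 2 1 0 8 3 15) (split 18 17 (cycle₈ 18 9 2 1 0 8 15 17) (split 18 2
  (expand 9 (far 19 9 2 1 (far 19 9 18 2 (split 19 0 (cycle₈ 19 0 1 7 10 3 2 9) (split 19 8
  (cycle₈ 19 8 0 7 1 2 18 9) (split 19 15 (cycle₈ 19 9 2 1 0 8 3 15) (split 19 17
  (cycle₈ 19 9 2 1 0 8 15 17) (path (17 ∷ 15 ∷ 8 ∷ 0 ∷ 1 ∷ 2 ∷ 9 ∷ 19 ∷ [])))))))))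
  (path (17 ∷ 15 ∷ 8 ∷ 0 ∷ 1 ∷ 2 ∷ 9 ∷ 18 ∷ [])))))))))))))))))) (expand 9 (far 16 9 2 1
  (split 16 0 (cycle₈ 16 0 1 7 10 3 2 9) (split 16 8 (cycle₈ 16 8 0 7 10 3 2 9) (split 16 15
  (cycle₈ 16 9 2 1 7 0 8 15) (split 16 2 (expand 9 (far 17 9 2 1 (far 17 9 16 2 (split 17 0
  (cycle₈ 17 0 1 7 10 3 2 9) (split 17 8 (cycle₈ 17 8 0 7 1 2 16 9) (split 17 15
  (cycle₈ 17 9 2 1 7 0 8 15) (expand 15 (far 18 15 8 0 (split 18 1 (cycle₈ 18 1 0 7 10 3 8 15)
  (split 18 2 (cycle₈ 18 2 1 7 10 3 8 15) (split 18 9 (cycle₈ 18 9 2 1 7 0 8 15) (split 18 17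
  (cycle₈ 18 15 8 0 1 2 9 17) (split 18 8 (expand 15 (far 19 15 8 0 (far 19 15 18 8 (split 19 1
  (cycle₈ 19 1 0 7 10 3 8 15) (split 19 2 (cycle₈ 19 2 1 7 0 8 18 15) (split 19 9
  (cycle₈ 19 9 2 1 0 8 18 15) (split 19 17 (cycle₈ 19 15 8 0 1 2 9 17)
  (path (17 ∷ 9 ∷ 2 ∷ 1 ∷ 0 ∷ 8 ∷ 15 ∷ 19 ∷ [])))))))))
  (path (17 ∷ 9 ∷ 2 ∷ 1 ∷ 0 ∷ 8 ∷ 15 ∷ 18 ∷ []))))))))))))))) (expand 15 (far 17 15 8 0
  (split 17 1 (cycle₈ 17 1 0 7 10 3 8 15) (split 17 2 (cycle₈ 17 2 1 7 10 3 8 15) (split 17 9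
  (cycle₈ 17 9 2 1 7 0 8 15) (split 17 16 (cycle₈ 17 15 8 0 1 2 9 16) (split 17 8 (expand 15
  (far 18 15 8 0 (far 18 15 17 8 (split 18 1 (cycle₈ 18 1 0 7 10 3 8 15) (split 18 2
  (cycle₈ 18 2 1 7 0 8 17 15) (split 18 9 (cycle₈ 18 9 2 1 0 8 17 15) (split 18 16
  (cycle₈ 18 15 8 0 1 2 9 16) (path (16 ∷ 9 ∷ 2 ∷ 1 ∷ 0 ∷ 8 ∷ 15 ∷ 18 ∷ [])))))))))
  (path (16 ∷ 9 ∷ 2 ∷ 1 ∷ 0 ∷ 8 ∷ 15 ∷ 17 ∷ []))))))))))))))))))))))))))))))))))))
  (path (0 ∷ 1 ∷ 2 ∷ 3 ∷ 4 ∷ 5 ∷ 11 ∷ 13 ∷ [])))))))))))))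
  (path (0 ∷ 1 ∷ 2 ∷ 3 ∷ 4 ∷ 5 ∷ 6 ∷ 12 ∷ [])))))))))))))))
  (path (0 ∷ 1 ∷ 2 ∷ 3 ∷ 4 ∷ 5 ∷ 6 ∷ 11 ∷ []))))))))))
  (path (6 ∷ 5 ∷ 4 ∷ 3 ∷ 8 ∷ 0 ∷ 7 ∷ 10 ∷ [])))))))))))))))))))))) (split 8 4 (expand 2
  (far 9 2 1 0 (far 9 2 3 4 (far 9 2 1 7 (split 9 1 (cycle₈ 9 1 7 0 8 4 3 2) (split 9 5
  (cycle₈ 9 2 1 7 0 8 4 5) (split 9 6 (cycle₈ 9 2 1 0 8 4 5 6) (split 9 8
  (path (6 ∷ 5 ∷ 4 ∷ 8 ∷ 9 ∷ 2 ∷ 1 ∷ 7 ∷ [])) (path (6 ∷ 5 ∷ 4 ∷ 8 ∷ 0 ∷ 1 ∷ 2 ∷ 9 ∷ []))))))))))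
  (path (6 ∷ 5 ∷ 4 ∷ 3 ∷ 2 ∷ 1 ∷ 0 ∷ 8 ∷ [])))))))))))) (split 7 4 (split 7 5 (expand 0
  (far 8 0 1 2 (far 8 0 7 4 (far 8 0 7 5 (split 8 1 (cycle₈ 8 0 7 5 4 3 2 1) (split 8 6
  (cycle₈ 8 0 1 2 3 4 5 6) (split 8 3 (expand 1 (far 9 1 2 3 (far 9 1 0 8 (split 9 0
  (cycle₈ 9 0 7 5 4 3 2 1) (split 9 4 (cycle₈ 9 1 2 3 8 0 7 4) (split 9 5
  (cycle₈ 9 1 0 8 3 4 7 5) (split 9 6 (cycle₈ 9 1 0 8 3 4 5 6)
  (path (6 ∷ 5 ∷ 4 ∷ 3 ∷ 8 ∷ 0 ∷ 1 ∷ 9 ∷ [])))))))))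
  (path (6 ∷ 5 ∷ 4 ∷ 3 ∷ 2 ∷ 1 ∷ 0 ∷ 8 ∷ []))))))))) (expand 6 (far 8 6 5 4 (split 8 0
  (cycle₈ 8 0 1 2 3 4 5 6) (split 8 2 (cycle₈ 8 2 1 0 7 4 5 6) (split 8 3 (far 8 3 2 1
  (far 8 3 4 5 (far 8 3 4 7 (path (7 ∷ 0 ∷ 1 ∷ 2 ∷ 3 ∷ 8 ∷ 6 ∷ 5 ∷ []))))) (split 8 1 (expand 6
  (far 9 6 8 1 (far 9 6 5 4 (split 9 0 (cycle₈ 9 0 1 2 3 4 5 6) (split 9 2
  (cycle₈ 9 2 1 0 7 4 5 6) (split 9 3 (cycle₈ 9 3 4 7 0 1 8 6) (split 9 5
  (cycle₈ 9 5 4 3 2 1 8 6) (path (0 ∷ 1 ∷ 2 ∷ 3 ∷ 4 ∷ 5 ∷ 6 ∷ 9 ∷ []))))))))) (split 8 5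
  (expand 6 (far 9 6 5 4 (far 9 6 8 5 (split 9 0 (cycle₈ 9 0 1 2 3 4 5 6) (split 9 1
  (cycle₈ 9 1 0 7 4 5 8 6) (split 9 2 (cycle₈ 9 2 1 0 7 4 5 6) (split 9 3 (far 9 3 4 7
  (path (7 ∷ 0 ∷ 1 ∷ 2 ∷ 3 ∷ 9 ∷ 6 ∷ 5 ∷ []))) (path (0 ∷ 1 ∷ 2 ∷ 3 ∷ 4 ∷ 5 ∷ 6 ∷ 9 ∷ [])))))))))
  -- At `split 7 5`, an edge makes `0 1 2 3 4 5 7` a C₇ with 6 attached at 5. A neighbour 8 of 0
  -- that sees 1 or 7 can be inserted into an edge of the C₇, which gives a C₈.
  (path (0 ∷ 1 ∷ 2 ∷ 3 ∷ 4 ∷ 5 ∷ 6 ∷ 8 ∷ [])))))))))) (split 7 5 (expand 0 (far 8 0 1 2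
  (far 8 0 7 5 (split 8 1 (cycle₈ 8 0 7 5 4 3 2 1) (split 8 6 (cycle₈ 8 0 1 2 3 4 5 6) (split 8 7
  (cycle₈ 8 0 1 2 3 4 5 7) (split 8 3 (split 8 4 (cycle₈ 8 3 2 1 0 7 5 4) (expand 1 (far 9 1 2 3
  (far 9 1 0 8 (split 9 0 (cycle₈ 9 0 7 5 4 3 2 1) (split 9 2 (cycle₈ 9 1 0 7 5 4 3 2) (split 9 5
  (cycle₈ 9 1 2 3 8 0 7 5) (split 9 6 (cycle₈ 9 1 0 8 3 4 5 6) (split 9 4 (expand 2 (far 10 2 1 0
  (far 10 2 3 8 (split 10 3 (cycle₈ 10 2 1 0 7 5 4 3) (split 10 5 (cycle₈ 10 2 1 0 8 3 4 5)
  (split 10 6 (cycle₈ 10 2 3 8 0 7 5 6) (split 10 7 (cycle₈ 10 2 3 4 9 1 0 7)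
  (path (6 ∷ 5 ∷ 7 ∷ 0 ∷ 8 ∷ 3 ∷ 2 ∷ 10 ∷ [])))))))))
  (path (6 ∷ 5 ∷ 4 ∷ 3 ∷ 8 ∷ 0 ∷ 1 ∷ 9 ∷ []))))))))))) (split 8 4 (expand 2 (far 9 2 1 0
  (far 9 2 3 4 (split 9 1 (cycle₈ 9 1 0 7 5 4 3 2) (split 9 5 (cycle₈ 9 2 3 4 8 0 7 5) (split 9 6
  (cycle₈ 9 2 1 0 8 4 5 6) (split 9 8 (cycle₈ 9 2 1 0 7 5 4 8)
  (path (6 ∷ 5 ∷ 4 ∷ 8 ∷ 0 ∷ 1 ∷ 2 ∷ 9 ∷ [])))))))))
  (path (6 ∷ 5 ∷ 4 ∷ 3 ∷ 2 ∷ 1 ∷ 0 ∷ 8 ∷ []))))))))))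
  (path (6 ∷ 5 ∷ 4 ∷ 3 ∷ 2 ∷ 1 ∷ 0 ∷ 7 ∷ []))))))))

-- From a single vertex to P₈.

inducedPath₁ : ∀ {n} → 1 ≤ n → (G : Graph n) → HasInducedPath G 1
inducedPath₁ 1≤n G = (λ _ → fromℕ< 1≤n) , (λ { {zero} {zero} _ → refl }) , λ where
  zero zero → mk⇔ (λ a → contradiction a (irrefl G)) λ { (inj₁ ()) ; (inj₂ ()) }

theorem1p2 : ∀ {n} → 1 ≤ n → (G : Graph n)
    → ¬ HasInducedPath G 8
    → (∀ (v : Fin n) → 3 ≤ degree G v)
    → HasCycle G 4 ⊎ HasCycle G 8
theorem1p2 1≤n G noP₈ deg≥3 = [ (λ P₈ → contradiction P₈ noP₈) , id ]′ P₈-or-cycle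
  where
  extend : ∀ {m} (c : Certificate (suc (suc m))) → T (check (suc m) (pathFacts (suc m)) c) →
    Outcome G (suc m) → Outcome G (suc (suc m))
  extend = lengthen G deg≥3

  P₈-or-cycle : Outcome G 8
  P₈-or-cycle = extend certificate8 _ (extend certificate7 _ (extend certificate6 _
    (extend certificate5 _ (extend certificate4 _ (extend certificate3 _ (extend certificate2 _
      (inj₁ (inducedPath₁ 1≤n G))))))))
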